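{- The competitive ratio of the (offline-chosen) better algorithm between MTFO and MTFE is at least $1.75$ and at most $2$ (full cost model). That is: (i) for every list and every sequence $\sigma$, $\min\{\mathrm{MTFO}(\sigma),\mathrm{MTFE}(\sigma)\}\le 2\,\mathrm{OPT}(\sigma)$; and (ii) for every $c<1.75$ and every constant $b$ there exist a list and a sequence $\sigma$ with $\min\{\mathrm{MTFO}(\sigma),\mathrm{MTFE}(\sigma)\}>c\cdot\mathrm{OPT}(\sigma)+b$.
   Context: Static list update: a list of distinct items in some initial order; serving a request to the item at position $i$ (from the front) costs $i$ (full cost model); the accessed item may be moved closer to the front for free; two adjacent items may be swapped at cost $1$. $A(\sigma)$ is the total cost of algorithm $A$ and $\mathrm{OPT}(\sigma)$ the minimum cost of any offline algorithm from the same initial list. MTFO moves a requested item to the front on the 1st, 3rd, 5th, ... request to that item; MTFE on the 2nd, 4th, 6th, ... request; otherwise they leave it in place, and they make no paid exchanges. -}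

module Defs where

open import Data.List.Base
  using (List; []; _∷_; _++_; length; take; drop; filter; takeWhile)
open import Data.List.Membership.Propositional using (_∈_)
open import Data.List.Relation.Unary.All using (All)
open import Data.List.Relation.Unary.Unique.Propositional using (Unique)
open import Data.Nat.Base
open import Data.Nat.Properties
open import Data.Parity.Base using (Parity; 0ℙ; 1ℙ)
import Data.Parity.Properties as ℙ
open import Data.Product.Base using (∃; _×_; _,_; proj₁)
open import Data.Sum.Base using (_⊎_; inj₁; inj₂)
open import Relation.Binary.Definitions using (DecidableEquality)
open import Relation.Binary.PropositionalEquality using (subst)
open import Relation.Nullary.Decidable
  using (Dec; yes; no; ¬?; map′; _×-dec_; _⊎-dec_)

module ListUpdate {A : Set} (_≟ᴬ_ : DecidableEquality A) where

  -- Positions are counted from 0 here, so accessing x costs suc (index x l).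
  -- Both functions are meaningful only when x occurs in l.
  index : A → List A → ℕ
  index x l = length (takeWhile (λ y → ¬? (x ≟ᴬ y)) l)

  -- For a list l of distinct items, moveTo (index x l) x l is l itself.
  moveTo : ℕ → A → List A → List A
  moveTo j x l = take j rest ++ x ∷ drop j rest
    where
    rest : List A
    rest = filter (λ y → ¬? (x ≟ᴬ y)) l

  swapAt : ℕ → List A → List A
  swapAt zero    (x ∷ y ∷ l) = y ∷ x ∷ l
  swapAt (suc i) (x ∷ l)     = x ∷ swapAt i l
  swapAt _       l           = l

  -- The behaviours of an arbitrary offline algorithm that starts with the
  -- given list and serves the given requests: exchange is a paid exchange,
  -- access serves a request and then moves the item, for free, forward to
  -- position j (or leaves it in place).
  data Schedule : List A → List A → Set where
    done     : ∀ {l} → Schedule l []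
    exchange : ∀ {l σ} i → suc i < length l →
               Schedule (swapAt i l) σ → Schedule l σ
    access   : ∀ {l x σ} j → j ≤ index x l →
               Schedule (moveTo j x l) σ → Schedule l (x ∷ σ)

  cost : ∀ {l σ} → Schedule l σ → ℕ
  cost done                           = 0
  cost (exchange _ _ s)               = 1 + cost s
  cost (access {l = l} {x = x} _ _ s) = suc (index x l) + cost s

  -- Moves x to the front on exactly those requests to x whose ordinal number
  -- among the requests to x (starting at 1) has parity p; h holds the requests
  -- served so far.
  mtf : Parity → (h l σ : List A) → Schedule l σ
  mtf p h l []      = done
  mtf p h l (x ∷ σ) with parity (suc (length (filter (x ≟ᴬ_) h))) ℙ.≟ p
  ... | yes _ = access 0 z≤n (mtf p (x ∷ h) _ σ)
  ... | no  _ = access (index x l) ≤-refl (mtf p (x ∷ h) _ σ)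

  MTFO MTFE : (l σ : List A) → ℕ
  MTFO l σ = cost (mtf 1ℙ [] l σ)
  MTFE l σ = cost (mtf 0ℙ [] l σ)

  Within : ℕ → List A → List A → Set
  Within n l σ = ∃ λ (s : Schedule l σ) → cost s ≤ n

  private
    ViaExchange : ℕ → List A → List A → Set
    ViaExchange n l σ =
      ∃ λ i → i < length l × suc i < length l × Within n (swapAt i l) σ

    ViaAccess : ℕ → List A → A → List A → Set
    ViaAccess n l x σ =
      suc (index x l) ≤ n ×
      ∃ λ j → j < suc (index x l) × Within (n ∸ suc (index x l)) (moveTo j x l) σ

    fromExchange : ∀ {n l σ} → ViaExchange n l σ → Within (suc n) l σ
    fromExchange (i , _ , i< , s , s≤n) = exchange i i< s , s≤s s≤n

    fromAccess : ∀ {n l x σ} → ViaAccess n l x σ → Within n l (x ∷ σ)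
    fromAccess {n} {l} {x} (c≤n , j , s≤s j≤ , s , s≤) =
      access j j≤ s ,
      subst (suc (index x l) + cost s ≤_) (m+[n∸m]≡n c≤n) (+-monoʳ-≤ (suc (index x l)) s≤)

    toAccess : ∀ {n l x σ} j (j≤ : j ≤ index x l) (s : Schedule (moveTo j x l) σ) →
               cost (access {l} {x} {σ} j j≤ s) ≤ n → ViaAccess n l x σ
    toAccess {n} {l} {x} j j≤ s le =
      m+n≤o⇒m≤o (suc (index x l)) le , j , s≤s j≤ , s ,
      m+n≤o⇒m≤o∸n (cost s) (subst (_≤ n) (+-comm (suc (index x l)) (cost s)) le)

    toEither : ∀ {n l x σ} → Within (suc n) l (x ∷ σ) →
               ViaExchange n l (x ∷ σ) ⊎ ViaAccess (suc n) l x σ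
    toEither {l = l} (access j j≤ s , le) = inj₂ (toAccess {l = l} j j≤ s le)
    toEither (exchange i i< s , s≤s s≤n) =
      inj₁ (i , ≤-trans (n≤1+n _) i< , i< , s , s≤n)

    fromEither : ∀ {n l x σ} → ViaExchange n l (x ∷ σ) ⊎ ViaAccess (suc n) l x σ →
                 Within (suc n) l (x ∷ σ)
    fromEither (inj₁ e) = fromExchange e
    fromEither {l = l} (inj₂ a) = fromAccess {l = l} a

  within? : ∀ n l σ → Dec (Within n l σ)
  within? n       l []      = yes (done , z≤n)
  within? zero    l (x ∷ σ) = no λ where
    (exchange _ _ _ , ())
    (access _ _ _ , ())
  within? (suc n) l (x ∷ σ) = map′ fromEither toEither
    (anyUpTo? (λ i → suc i <? length l ×-dec within? n (swapAt i l) (x ∷ σ)) (length l)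
     ⊎-dec
     (suc (index x l) ≤? suc n ×-dec
      anyUpTo? (λ j → within? (suc n ∸ suc (index x l)) (moveTo j x l) σ) (suc (index x l))))

  Optimal : ∀ {l σ} → Schedule l σ → Set
  Optimal {l} {σ} s = ∀ (s′ : Schedule l σ) → cost s ≤ cost s′

  private
    search : ∀ n {l σ} → Within n l σ → ∃ λ (s : Schedule l σ) → Optimal s
    search zero    (s , s≤0) = s , λ _ → ≤-trans s≤0 z≤n
    search (suc n) {l} {σ} (s , s≤) with within? n l σ
    ... | yes w = search n w
    ... | no ¬w = s , λ s′ → ≤-trans s≤ (≰⇒> λ s′≤n → ¬w (s′ , s′≤n))

  optimal : ∀ l σ → ∃ λ (s : Schedule l σ) → Optimal s
  optimal l σ = search (MTFO l σ) (mtf 1ℙ [] l σ , ≤-refl)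

  OPT : (l σ : List A) → ℕ
  OPT l σ = cost (proj₁ (optimal l σ))

record Instance : Set₁ where
  field
    {Item}    : Set
    _≟ᴵ_      : DecidableEquality Item
    initial   : List Item
    distinct  : Unique initial
    requests  : List Item
    available : All (_∈ initial) requests

MTFO MTFE OPT : Instance → ℕ
MTFO I = ListUpdate.MTFO (_≟ᴵ_ I) (initial I) (requests I)
  where open Instance
MTFE I = ListUpdate.MTFE (_≟ᴵ_ I) (initial I) (requests I)
  where open Instance
OPT  I = ListUpdate.OPT  (_≟ᴵ_ I) (initial I) (requests I)
  where open Instance

module Submission where

-- Upper bound.  The relative order of two items a, b in the list of MTFO, of
-- MTFE and of the offline algorithm, together with the parities of the numbers
-- of requests to a and b, is a finite state.  A potential φ of this state pays,
-- pair by pair, for MTFO + MTFE ≤ 4 OPT; summing it over all pairs bounds the sum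
-- of the two costs, and the minimum is at most half of the sum.
--
-- Lower bound.  On a list l = a₁ … aₙ request a₁ … aₙ and then a₁ a₁ … aₙ aₙ.  An
-- algorithm that starts by moving pays about 5 n²/2 (the first pass reverses its
-- list, and then every request hits the last item); one that starts by staying
-- pays about 2 n²/2, and so does the offline algorithm that imitates it.  Both
-- end with the reversed list.  Each item has been requested three times, so when
-- this is repeated on the reversed list, MTFO and MTFE have swapped roles: both
-- pay about 7 n²/2 per two repetitions, and OPT at most about 4 n²/2.

open import Defs
open import Data.Bool.Base using (Bool; true; false; not; _∧_; _∨_; if_then_else_)
import Data.Bool.Properties as Bool
open import Data.Integer.Base as ℤ using (+_; -[1+_])
import Data.Integer.Properties as ℤ
open import Data.List.Base
  using (List; []; _∷_; _++_; map; length; take; drop; filter; reverse; _ʳ++_;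
         concatMap; upTo)
open import Data.List.Membership.Propositional using (_∈_)
open import Data.List.Membership.Propositional.Properties using (∈-++⁻)
open import Data.List.Properties
  using (filter-all; take++drop≡id; ++-assoc; ++-identityʳ; ʳ++-defn; length-reverse;
         length-++; length-upTo; unfold-reverse; reverse-involutive)
open import Data.List.Relation.Binary.Permutation.Propositional
  using (_↭_; ↭-refl; ↭-sym; ↭-trans; ↭⇒↭ₛ; ↭-reflexive; prep; swap)
open import Data.List.Relation.Binary.Permutation.Propositional.Properties
  using (∈-resp-↭; shift; map⁺; ↭-reverse)
open import Data.List.Relation.Binary.Permutation.Setoid.Properties using (Unique-resp-↭)
open import Data.List.Relation.Unary.All as All using (All; []; _∷_)
import Data.List.Relation.Unary.All.Properties as All
open import Data.List.Relation.Unary.AllPairs using ([]; _∷_)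
open import Data.List.Relation.Unary.Any using (here; there)
open import Data.List.Relation.Unary.Unique.Propositional using (Unique)
open import Data.List.Relation.Unary.Unique.Propositional.Properties using (upTo⁺)
open import Data.Nat.Base as ℕ using (ℕ; zero; suc; z≤n; s≤s)
open import Data.Nat.ListAction using (sum)
open import Data.Nat.ListAction.Properties using (sum-↭)
import Data.Nat.Properties as ℕ
open import Data.Nat.Solver using (module +-*-Solver)
open import Data.Parity.Base using (Parity; 0ℙ; 1ℙ; _⁻¹)
import Data.Parity.Properties as ℙ
open import Data.Product.Base using (∃₂; _×_; _,_; proj₁; proj₂; ∃-syntax)
open import Data.Rational.Base as ℚ using (ℚ; mkℚ; _/_; _+_; _*_; _<_; toℚᵘ)
import Data.Rational.Properties as ℚ
open import Data.Rational.Unnormalised.Base as ℚᵘ using (ℚᵘ; mkℚᵘ)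
import Data.Rational.Unnormalised.Properties as ℚᵘ
open import Data.Sum.Base using (_⊎_; inj₁; inj₂)
open import Data.Unit.Base using (tt)
open import Function.Base using (_∘_; const)
open import Relation.Binary.Definitions using (DecidableEquality)
open import Relation.Binary.PropositionalEquality
open import Relation.Nullary.Decidable
  using (Dec; yes; no; does; ¬?; map′; _×-dec_; _→-dec_; toWitness; dec-true; dec-false)
open import Relation.Nullary.Negation using (contradiction)

-- Nesting this decides statements about several Booleans, so the inequalities for the pair
-- potential are proved by evaluating all cases.
∀? : {P : Bool → Set} → (∀ b → Dec (P b)) → Dec (∀ b → P b)
∀? P? = map′ (λ (t , f) → λ where true → t ; false → f) (λ p → p true , p false)
  (P? true ×-dec P? false)

♯ : Bool → ℕ
♯ b = if b then 1 else 0

Unique-↭ : ∀ {A : Set} {k l : List A} → k ↭ l → Unique k → Unique l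
Unique-↭ k↭l = Unique-resp-↭ (setoid _) (↭⇒↭ₛ k↭l)

-- Sums over lists.

module Sums {A : Set} where

  Σ : List A → (A → ℕ) → ℕ
  Σ l f = sum (map f l)

  Σ-mono : ∀ l {f g : A → ℕ} → (∀ {a} → a ∈ l → f a ℕ.≤ g a) → Σ l f ℕ.≤ Σ l g
  Σ-mono []      f≤g = z≤n
  Σ-mono (x ∷ l) f≤g = ℕ.+-mono-≤ (f≤g (here refl)) (Σ-mono l (f≤g ∘ there))

  Σ-cong : ∀ l {f g : A → ℕ} → (∀ {a} → a ∈ l → f a ≡ g a) → Σ l f ≡ Σ l g
  Σ-cong []      f≡g = refl
  Σ-cong (x ∷ l) f≡g = cong₂ ℕ._+_ (f≡g (here refl)) (Σ-cong l (f≡g ∘ there))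

  Σ-+ : ∀ l (f g : A → ℕ) → Σ l (λ a → f a ℕ.+ g a) ≡ Σ l f ℕ.+ Σ l g
  Σ-+ []      f g = refl
  Σ-+ (x ∷ l) f g rewrite Σ-+ l f g = solve 4
    (λ a b c d → (a :+ b) :+ (c :+ d) := (a :+ c) :+ (b :+ d)) refl (f x) (g x) (Σ l f) (Σ l g)
    where open +-*-Solver

  Σ-* : ∀ l k (f : A → ℕ) → Σ l (λ a → k ℕ.* f a) ≡ k ℕ.* Σ l f
  Σ-* []      k f = sym (ℕ.*-zeroʳ k)
  Σ-* (x ∷ l) k f rewrite Σ-* l k f = sym (ℕ.*-distribˡ-+ k (f x) (Σ l f))

  Σ-0 : ∀ l → Σ l (const 0) ≡ 0
  Σ-0 []      = refl
  Σ-0 (x ∷ l) = Σ-0 l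

  Σ-↭ : ∀ {k l} (f : A → ℕ) → k ↭ l → Σ k f ≡ Σ l f
  Σ-↭ f k↭l = sum-↭ (map⁺ f k↭l)

open Sums

-- Relative order of two items under requests and exchanges.

module Lists {A : Set} (_≟ᴬ_ : DecidableEquality A) where
  open ListUpdate _≟ᴬ_

  -- Testing `b` first makes the relation irreflexive, so an item does not count itself among those
  -- ahead of it in `index-Σ`.
  before : A → A → List A → Bool
  before a b []      = false
  before a b (y ∷ l) =
    if does (b ≟ᴬ y) then false else (if does (a ≟ᴬ y) then true else before a b l)

  others : A → List A → List A
  others x = filter (λ y → ¬? (x ≟ᴬ y))

  others-all : ∀ {x l} → All (x ≢_) l → others x l ≡ l
  others-all = filter-all _

  before-irrefl : ∀ a l → before a a l ≡ false
  before-irrefl a []      = refl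
  before-irrefl a (y ∷ l) with a ≟ᴬ y
  ... | yes _ = refl
  ... | no  _ = before-irrefl a l

  before-antisym : ∀ {a b l} → a ≢ b → a ∈ l → b ∈ l → before b a l ≡ not (before a b l)
  before-antisym {a} {b} {y ∷ l} a≢b a∈ b∈ with a ≟ᴬ y | b ≟ᴬ y
  ... | yes refl | yes refl = contradiction refl a≢b
  ... | yes refl | no _     = refl
  ... | no _     | yes refl = refl
  before-antisym a≢b (here refl) b∈          | no a≢y | no b≢y = contradiction refl a≢y
  before-antisym a≢b (there a∈)  (here refl) | no a≢y | no b≢y = contradiction refl b≢y
  before-antisym a≢b (there a∈)  (there b∈)  | no a≢y | no b≢y = before-antisym a≢b a∈ b∈

  before-insert : ∀ {a b x} → a ≢ x → b ≢ x → ∀ k l →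
                  before a b (k ++ x ∷ l) ≡ before a b (k ++ l)
  before-insert {a} {b} {x} a≢x b≢x [] l
    rewrite dec-false (b ≟ᴬ x) b≢x | dec-false (a ≟ᴬ x) a≢x = refl
  before-insert {a} {b} a≢x b≢x (y ∷ k) l rewrite before-insert a≢x b≢x k l = refl

  before-others : ∀ {a b x} → a ≢ x → b ≢ x → ∀ l → before a b (others x l) ≡ before a b l
  before-others a≢x b≢x [] = refl
  before-others {a} {b} {x} a≢x b≢x (y ∷ l) with x ≟ᴬ y
  ... | yes refl rewrite dec-false (b ≟ᴬ x) b≢x | dec-false (a ≟ᴬ x) a≢x =
    before-others a≢x b≢x l
  ... | no _ rewrite before-others a≢x b≢x l = refl

  before-moveTo : ∀ {a b x} j → a ≢ x → b ≢ x → ∀ l →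
                  before a b (moveTo j x l) ≡ before a b l
  before-moveTo {a} {b} {x} j a≢x b≢x l = begin
    before a b (take j r ++ x ∷ drop j r)  ≡⟨ before-insert a≢x b≢x (take j r) _ ⟩
    before a b (take j r ++ drop j r)      ≡⟨ cong (before a b) (take++drop≡id j r) ⟩
    before a b r                           ≡⟨ before-others a≢x b≢x l ⟩
    before a b l                           ∎
    where
    open ≡-Reasoning
    r = others x l

  before-front : ∀ {x b} → b ≢ x → ∀ l → before x b (x ∷ l) ≡ true
  before-front {x} {b} b≢x l rewrite dec-false (b ≟ᴬ x) b≢x | dec-true (x ≟ᴬ x) refl = refl

  -- A free move never carries `x` backwards. In the inductive step the head is neither `x`, whose
  -- index would be 0, nor `b`, which would then precede `x`; so it is a common head that can be
  -- peeled off.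
  before-forward : ∀ {x b} → b ≢ x → ∀ j l → j ℕ.≤ index x l →
                   before x b l ≡ true → before x b (moveTo j x l) ≡ true
  before-forward {x} b≢x zero l _ _ = before-front b≢x (others x l)
  before-forward {x} {b} b≢x (suc j) (y ∷ l) j≤ e with x ≟ᴬ y
  ... | no x≢y with b ≟ᴬ y
  ...   | no _ rewrite dec-false (x ≟ᴬ y) x≢y = before-forward b≢x j l (ℕ.≤-pred j≤) e

  moveTo-index : ∀ {x l} → Unique l → x ∈ l → moveTo (index x l) x l ≡ l
  moveTo-index {x} {y ∷ l} (y∉l ∷ _) x∈ with x ≟ᴬ y
  ... | yes refl = cong (y ∷_) (others-all y∉l)
  moveTo-index (_ ∷ l!) (here refl) | no x≢y = contradiction refl x≢y
  moveTo-index (_ ∷ l!) (there x∈)  | no _   = cong (_ ∷_) (moveTo-index l! x∈)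

  others-↭ : ∀ {x l} → Unique l → x ∈ l → x ∷ others x l ↭ l
  others-↭ {x} {y ∷ l} (y∉l ∷ _) x∈ with x ≟ᴬ y
  ... | yes refl = ↭-reflexive (cong (y ∷_) (others-all y∉l))
  others-↭ (_ ∷ l!) (here refl) | no x≢y = contradiction refl x≢y
  others-↭ {x} {y ∷ l} (_ ∷ l!) (there x∈)  | no _ =
    ↭-trans (swap x y ↭-refl) (prep y (others-↭ l! x∈))

  moveTo-↭ : ∀ {x l} j → Unique l → x ∈ l → moveTo j x l ↭ l
  moveTo-↭ {x} {l} j l! x∈ = ↭-trans (shift x (take j r) (drop j r))
    (↭-trans (prep x (↭-reflexive (take++drop≡id j r))) (others-↭ l! x∈))
    where
    r = others x l

  swapAt-↭ : ∀ i l → swapAt i l ↭ l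
  swapAt-↭ zero    []          = ↭-refl
  swapAt-↭ zero    (x ∷ [])    = ↭-refl
  swapAt-↭ zero    (x ∷ y ∷ l) = swap y x ↭-refl
  swapAt-↭ (suc i) []          = ↭-refl
  swapAt-↭ (suc i) (x ∷ l)     = prep x (swapAt-↭ i l)

  -- The witnesses are the two swapped neighbours. Hence a paid exchange can alter the potential of
  -- two ordered pairs at most.
  before-swapAt : ∀ i l → suc i ℕ.< length l → ∃₂ λ u v → ∀ a b →
    before a b (swapAt i l) ≡ before a b l ⊎ (u ≡ a × v ≡ b) ⊎ (v ≡ a × u ≡ b)
  before-swapAt zero (x ∷ []) (s≤s ())
  before-swapAt zero (x ∷ y ∷ l) _ = x , y , same
    where
    same : ∀ a b → before a b (y ∷ x ∷ l) ≡ before a b (x ∷ y ∷ l) ⊎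
           (x ≡ a × y ≡ b) ⊎ (y ≡ a × x ≡ b)
    same a b with b ≟ᴬ x | b ≟ᴬ y | a ≟ᴬ x | a ≟ᴬ y
    ... | no _     | no _     | no _     | no _     = inj₁ refl
    ... | no _     | no _     | no _     | yes _    = inj₁ refl
    ... | no _     | no _     | yes _    | no _     = inj₁ refl
    ... | no _     | no _     | yes _    | yes _    = inj₁ refl
    ... | yes _    | yes _    | _        | _        = inj₁ refl
    ... | yes refl | no _     | _        | yes refl = inj₂ (inj₂ (refl , refl))
    ... | yes refl | no _     | _        | no _     = inj₁ refl
    ... | no _     | yes refl | yes refl | _        = inj₂ (inj₁ (refl , refl))
    ... | no _     | yes refl | no _     | _        = inj₁ refl
  before-swapAt (suc i) (x ∷ l) (s≤s i<) with before-swapAt i l i<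
  ... | u , v , same = u , v , same′
    where
    same′ : ∀ a b → before a b (x ∷ swapAt i l) ≡ before a b (x ∷ l) ⊎
            (u ≡ a × v ≡ b) ⊎ (v ≡ a × u ≡ b)
    same′ a b with same a b
    ... | inj₁ e rewrite e = inj₁ refl
    ... | inj₂ p = inj₂ p

  -- This splits an access cost into contributions of pairs, on which the pairwise analysis rests.
  index-Σ : ∀ {l} → Unique l → ∀ x → Σ l (λ b → ♯ (before b x l)) ≡ index x l
  index-Σ [] x = refl
  index-Σ {y ∷ l} (y∉l ∷ l!) x with x ≟ᴬ y
  ... | yes refl = Σ-0 l
  ... | no _ rewrite dec-true (y ≟ᴬ y) refl = cong suc (trans (Σ-cong l tail) (index-Σ l! x))
    where
    tail : ∀ {b} → b ∈ l → ♯ (if does (b ≟ᴬ y) then true else before b x l) ≡ ♯ (before b x l)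
    tail {b} b∈ rewrite dec-false (b ≟ᴬ y) (λ b≡y → All.lookup y∉l b∈ (sym b≡y)) = refl

  Σ-δ-absent : ∀ {x l} → All (x ≢_) l → (f : A → ℕ) →
               Σ l (λ a → if does (x ≟ᴬ a) then f a else 0) ≡ 0
  Σ-δ-absent []              f = refl
  Σ-δ-absent {x} {a ∷ l} (x≢a ∷ x∉l) f rewrite dec-false (x ≟ᴬ a) x≢a = Σ-δ-absent x∉l f

  -- The form for items not known to lie in `l`, such as the two that `before-swapAt` returns.
  Σ-δ-≤ : ∀ {l} → Unique l → ∀ x (f : A → ℕ) →
          Σ l (λ a → if does (x ≟ᴬ a) then f a else 0) ℕ.≤ f x
  Σ-δ-≤ [] x f = z≤n
  Σ-δ-≤ {a ∷ l} (a∉l ∷ l!) x f with x ≟ᴬ a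
  ... | yes refl = ℕ.≤-reflexive (trans (cong (f x ℕ.+_) (Σ-δ-absent a∉l f)) (ℕ.+-identityʳ _))
  ... | no  _    = Σ-δ-≤ l! x f

  Σ-δ : ∀ {l} → Unique l → ∀ {x} → x ∈ l → (f : A → ℕ) →
        Σ l (λ a → if does (x ≟ᴬ a) then f a else 0) ≡ f x
  Σ-δ {a ∷ l} (a∉l ∷ l!) {x} x∈ f with x ≟ᴬ a
  ... | yes refl = trans (cong (f x ℕ.+_) (Σ-δ-absent a∉l f)) (ℕ.+-identityʳ _)
  Σ-δ (_ ∷ l!) (here refl) f | no x≢a = contradiction refl x≢a
  Σ-δ (_ ∷ l!) (there x∈)  f | no _   = Σ-δ l! x∈ f

  -- The test made by `mtf`, as a Boolean, so that it can be part of the finite state of a pair.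
  moves : Parity → List A → A → Bool
  moves p h x = does (ℕ.parity (suc (length (filter (x ≟ᴬ_) h))) ℙ.≟ p)

  target : Bool → A → List A → ℕ
  target β x l = if β then 0 else index x l

  target≤ : ∀ β x l → target β x l ℕ.≤ index x l
  target≤ true  x l = z≤n
  target≤ false x l = ℕ.≤-refl

  serve : Bool → A → List A → List A
  serve β x l = moveTo (target β x l) x l

  -- Expressing both branches of `mtf` through `serve` lets later proofs treat moving and staying at
  -- once.
  mtf-step : ∀ p h l x σ → cost (mtf p h l (x ∷ σ)) ≡
             suc (index x l) ℕ.+ cost (mtf p (x ∷ h) (serve (moves p h x) x l) σ)
  mtf-step p h l x σ with ℕ.parity (suc (length (filter (x ≟ᴬ_) h))) ℙ.≟ p
  ... | yes _ = refl
  ... | no  _ = refl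

  does-⁻¹ : ∀ q p → does ((q ⁻¹) ℙ.≟ p) ≡ not (does (q ℙ.≟ p))
  does-⁻¹ 0ℙ 0ℙ = refl
  does-⁻¹ 0ℙ 1ℙ = refl
  does-⁻¹ 1ℙ 0ℙ = refl
  does-⁻¹ 1ℙ 1ℙ = refl

  -- Both algorithms see the same history, and a parity is one of two: at every request exactly one
  -- of them moves the item. One bit per item therefore describes both.
  moves-0ℙ : ∀ h x → moves 0ℙ h x ≡ not (moves 1ℙ h x)
  moves-0ℙ h x with ℕ.parity (suc (length (filter (x ≟ᴬ_) h)))
  ... | 0ℙ = refl
  ... | 1ℙ = refl

  parity-suc : ∀ n → ℕ.parity (suc n) ≡ ℕ.parity n ⁻¹
  parity-suc zero          = refl
  parity-suc (suc zero)    = refl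
  parity-suc (suc (suc n)) = parity-suc n

  moves-same : ∀ p h x → moves p (x ∷ h) x ≡ not (moves p h x)
  moves-same p h x rewrite dec-true (x ≟ᴬ x) refl
    | parity-suc (suc (length (filter (x ≟ᴬ_) h))) =
    does-⁻¹ (ℕ.parity (suc (length (filter (x ≟ᴬ_) h)))) p

  moves-other : ∀ p h {x y} → y ≢ x → moves p (x ∷ h) y ≡ moves p h y
  moves-other p h {x} {y} y≢x rewrite dec-false (y ≟ᴬ x) y≢x = refl

  serve-↭ : ∀ {x l} β → Unique l → x ∈ l → serve β x l ↭ l
  serve-↭ {x} {l} β = moveTo-↭ (target β x l)

  -- The new order is a Boolean function of the old order and the decision. This makes each pair a
  -- finite automaton whose transitions are those in `request-a`.
  before-serve : ∀ {x b l} β → Unique l → x ∈ l → b ≢ x →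
                 before x b (serve β x l) ≡ β ∨ before x b l
  before-serve {x} {b} {l} true  l! x∈ b≢x = before-front b≢x (others x l)
  before-serve {x} {b} {l} false l! x∈ b≢x = cong (before x b) (moveTo-index l! x∈)

  before-serve′ : ∀ {x a l} β → Unique l → x ∈ l → a ∈ l → a ≢ x →
                  before a x (serve β x l) ≡ not β ∧ before a x l
  before-serve′ {x} {a} {l} true  l! x∈ a∈ a≢x = trans
    (before-antisym (a≢x ∘ sym) (∈-resp-↭ (↭-sym (serve-↭ true l! x∈)) x∈)
      (∈-resp-↭ (↭-sym (serve-↭ true l! x∈)) a∈))
    (cong not (before-front a≢x (others x l)))
  before-serve′ {x} {a} {l} false l! x∈ a∈ a≢x = cong (before a x) (moveTo-index l! x∈)

-- The potential of a pair of items.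

-- o, e, p: whether a precedes b in the lists of MTFO, of MTFE and of the offline
-- algorithm; pa, pb: whether MTFO moves at the next request to a, to b.
-- When o and e differ, let z be the item that the offline algorithm has in front:
-- the potential is 1 if the next request to z is one at which the algorithm that
-- has z behind moves it, and 2 otherwise.
φ : (o e p pa pb : Bool) → ℕ
φ true  true  p pa pb = if p then 0 else 3
φ false false p pa pb = if p then 3 else 0
φ true  false p pa pb = if p then (if pa then 2 else 1) else (if pb then 1 else 2)
φ false true  p pa pb = if p then (if pa then 1 else 2) else (if pb then 2 else 1)

φ-agree : ∀ o pa pb → φ o o o pa pb ≡ 0
φ-agree = toWitness {a? = ∀? λ o → ∀? λ pa → ∀? λ pb → _ ℕ.≟ _} tt

-- Used for paid exchanges: 4 is the share of each of the two ordered pairs that an exchange can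
-- reverse, and it covers any new value of the potential.
φ-≤ : ∀ o e p pa pb → φ o e p pa pb ℕ.≤ 4
φ-≤ = toWitness {a? = ∀? λ o → ∀? λ e → ∀? λ p → ∀? λ pa → ∀? λ pb → _ ℕ.≤? _} tt

-- While only the item that the offline algorithm has in front is requested and stays there, `φ` is
-- exactly what MTFO and MTFE together still pay for the pair, so such requests balance. A request
-- to the other item costs the offline algorithm 1, and 4 covers both the payments and the rise of
-- `φ`. The hypothesis says that a free move only goes forward.
request-a : ∀ o e p p′ pa pb → (p ≡ true → p′ ≡ true) →
  (♯ (not o) ℕ.+ ♯ (not e)) ℕ.+ φ (pa ∨ o) (not pa ∨ e) p′ (not pa) pb
  ℕ.≤ 4 ℕ.* ♯ (not p) ℕ.+ φ o e p pa pb
request-a = toWitness {a? = ∀? λ o → ∀? λ e → ∀? λ p → ∀? λ p′ → ∀? λ pa → ∀? λ pb →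
  ((p Bool.≟ true) →-dec (p′ Bool.≟ true)) →-dec (_ ℕ.≤? _)} tt

-- The mirror image of `request-a`. The double negation arises from `before-serve′` because MTFE
-- moves when `pb` is false.
request-b : ∀ o e p p′ pa pb → (p ≡ false → p′ ≡ false) →
  (♯ o ℕ.+ ♯ e) ℕ.+ φ (not pb ∧ o) (not (not pb) ∧ e) p′ pa (not pb)
  ℕ.≤ 4 ℕ.* ♯ p ℕ.+ φ o e p pa pb
request-b = toWitness {a? = ∀? λ o → ∀? λ e → ∀? λ p → ∀? λ p′ → ∀? λ pa → ∀? λ pb →
  ((p Bool.≟ false) →-dec (p′ Bool.≟ false)) →-dec (_ ℕ.≤? _)} tt

-- Upper bound: summing the pair inequalities.

module Upper {A : Set} (_≟ᴬ_ : DecidableEquality A) where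
  open ListUpdate _≟ᴬ_
  open Lists _≟ᴬ_

  -- The share of the ordered pair (a , b) in the cost of a request to x; every cost
  -- is counted twice, once for each order of the pair.
  charge : A → List A → A → A → ℕ
  charge x l a b = (if does (x ≟ᴬ a) then ♯ (before b x l) else 0) ℕ.+
                   (if does (x ≟ᴬ b) then ♯ (before a x l) else 0)

  Φ : (O E P h : List A) → A → A → ℕ
  Φ O E P h a b = if does (a ≟ᴬ b) then 0 else
    φ (before a b O) (before a b E) (before a b P) (moves 1ℙ h a) (moves 1ℙ h b)

  charge-diagonal : ∀ x l a → charge x l a a ≡ 0
  charge-diagonal x l a with x ≟ᴬ a
  ... | yes refl rewrite before-irrefl x l = refl
  ... | no  _    = refl

  Φ-diagonal : ∀ O E P h a → Φ O E P h a a ≡ 0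
  Φ-diagonal O E P h a rewrite dec-true (a ≟ᴬ a) refl = refl

  Φ-off : ∀ {O E P h a b} → a ≢ b → Φ O E P h a b ≡
    φ (before a b O) (before a b E) (before a b P) (moves 1ℙ h a) (moves 1ℙ h b)
  Φ-off {a = a} {b} a≢b rewrite dec-false (a ≟ᴬ b) a≢b = refl

  charge-a : ∀ {x b} l → x ≢ b → x ∈ l → b ∈ l → charge x l x b ≡ ♯ (not (before x b l))
  charge-a {x} {b} l x≢b x∈ b∈ rewrite dec-true (x ≟ᴬ x) refl | dec-false (x ≟ᴬ b) x≢b =
    trans (ℕ.+-identityʳ _) (cong ♯ (before-antisym x≢b x∈ b∈))

  charge-b : ∀ {x a} l → x ≢ a → charge x l a x ≡ ♯ (before a x l)
  charge-b {x} {a} l x≢a rewrite dec-true (x ≟ᴬ x) refl | dec-false (x ≟ᴬ a) x≢a = refl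

  charge-neither : ∀ {x a b} l → x ≢ a → x ≢ b → charge x l a b ≡ 0
  charge-neither {x} {a} {b} l x≢a x≢b
    rewrite dec-false (x ≟ᴬ a) x≢a | dec-false (x ≟ᴬ b) x≢b = refl

  module _ {L : List A} (L! : Unique L) where

    in-list : ∀ {l x} → l ↭ L → x ∈ L → x ∈ l
    in-list l↭L = ∈-resp-↭ (↭-sym l↭L)

    distinct-↭ : ∀ {l} → l ↭ L → Unique l
    distinct-↭ l↭L = Unique-↭ (↭-sym l↭L) L!

    ΣΣ : (A → A → ℕ) → ℕ
    ΣΣ f = Σ L λ a → Σ L (f a)

    ΣΣ-mono : ∀ {f g : A → A → ℕ} → (∀ {a b} → a ∈ L → b ∈ L → f a b ℕ.≤ g a b) → ΣΣ f ℕ.≤ ΣΣ g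
    ΣΣ-mono f≤g = Σ-mono L λ a∈ → Σ-mono L (f≤g a∈)

    ΣΣ-+ : ∀ f g → ΣΣ (λ a b → f a b ℕ.+ g a b) ≡ ΣΣ f ℕ.+ ΣΣ g
    ΣΣ-+ f g = trans (Σ-cong L λ {a} _ → Σ-+ L (f a) (g a)) (Σ-+ L _ _)

    ΣΣ-* : ∀ k f → ΣΣ (λ a b → k ℕ.* f a b) ≡ k ℕ.* ΣΣ f
    ΣΣ-* k f = trans (Σ-cong L λ {a} _ → Σ-* L k (f a)) (Σ-* L k _)

    ΣΣ-δ : ∀ u v → ΣΣ (λ a b → if does (u ≟ᴬ a) then (if does (v ≟ᴬ b) then 1 else 0) else 0) ℕ.≤ 1
    ΣΣ-δ u v = ℕ.≤-trans
      (Σ-mono L λ {a} _ → row a)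
      (Σ-δ-≤ L! u (const 1))
      where
      row : ∀ a → Σ L (λ b → if does (u ≟ᴬ a) then (if does (v ≟ᴬ b) then 1 else 0) else 0)
            ℕ.≤ (if does (u ≟ᴬ a) then 1 else 0)
      row a with does (u ≟ᴬ a)
      ... | true  = Σ-δ-≤ L! v (const 1)
      ... | false = ℕ.≤-reflexive (Σ-0 L)

    -- The row of `x` and the column of `x` each add up to its position, by `index-Σ`.
    ΣΣ-charge : ∀ {x l} → l ↭ L → x ∈ L → ΣΣ (charge x l) ≡ 2 ℕ.* index x l
    ΣΣ-charge {x} {l} l↭L x∈ = begin
      ΣΣ (charge x l)
        ≡⟨ ΣΣ-+ (λ a b → if does (x ≟ᴬ a) then ♯ (before b x l) else 0) _ ⟩
      Σ L (λ a → Σ L λ b → if does (x ≟ᴬ a) then ♯ (before b x l) else 0) ℕ.+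
      Σ L (λ a → Σ L λ b → if does (x ≟ᴬ b) then ♯ (before a x l) else 0)
        ≡⟨ cong₂ ℕ._+_ (Σ-cong L λ {a} _ → pull a) (Σ-cong L λ _ → Σ-δ L! x∈ _) ⟩
      Σ L (λ a → if does (x ≟ᴬ a) then Σ L (λ b → ♯ (before b x l)) else 0) ℕ.+
      Σ L (λ a → ♯ (before a x l))
        ≡⟨ cong₂ ℕ._+_ (trans (Σ-δ L! x∈ _) ahead) ahead ⟩
      index x l ℕ.+ index x l
        ≡⟨ cong (index x l ℕ.+_) (sym (ℕ.+-identityʳ _)) ⟩
      2 ℕ.* index x l
        ∎
      where
      open ≡-Reasoning
      pull : ∀ a → Σ L (λ b → if does (x ≟ᴬ a) then ♯ (before b x l) else 0) ≡
             (if does (x ≟ᴬ a) then Σ L (λ b → ♯ (before b x l)) else 0)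
      pull a with does (x ≟ᴬ a)
      ... | true  = refl
      ... | false = Σ-0 L
      ahead : Σ L (λ b → ♯ (before b x l)) ≡ index x l
      ahead = trans (Σ-↭ _ (↭-sym l↭L)) (index-Σ (distinct-↭ l↭L) x)

    -- On the diagonal everything on the left vanishes, and a pair without `x` keeps its state. The
    -- two remaining cases are `request-a` and `request-b`.
    access-pair : ∀ {O E P h x} j → O ↭ L → E ↭ L → P ↭ L → x ∈ L → j ℕ.≤ index x P →
      ∀ {a b} → a ∈ L → b ∈ L →
      (charge x O a b ℕ.+ charge x E a b) ℕ.+
        Φ (serve (moves 1ℙ h x) x O) (serve (moves 0ℙ h x) x E) (moveTo j x P) (x ∷ h) a b
      ℕ.≤ 4 ℕ.* charge x P a b ℕ.+ Φ O E P h a b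
    access-pair {O} {E} {P} {h} {x} j O↭ E↭ P↭ x∈ j≤ {a} {b} a∈ b∈ =
      by-cases (a ≟ᴬ b) (x ≟ᴬ a) (x ≟ᴬ b)
      where
      O′ = serve (moves 1ℙ h x) x O
      E′ = serve (moves 0ℙ h x) x E
      P′ = moveTo j x P
      P′↭ : P′ ↭ L
      P′↭ = ↭-trans (moveTo-↭ j (distinct-↭ P↭) (in-list P↭ x∈)) P↭

      by-cases : Dec (a ≡ b) → Dec (x ≡ a) → Dec (x ≡ b) →
                 (charge x O a b ℕ.+ charge x E a b) ℕ.+ Φ O′ E′ P′ (x ∷ h) a b
                 ℕ.≤ 4 ℕ.* charge x P a b ℕ.+ Φ O E P h a b
      by-cases (yes refl) _ _
        rewrite charge-diagonal x O a | charge-diagonal x E a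
              | Φ-diagonal O′ E′ P′ (x ∷ h) a
        = z≤n
      by-cases (no a≢b) (yes refl) _
        rewrite Φ-off {O} {E} {P} {h} a≢b | Φ-off {O′} {E′} {P′} {x ∷ h} a≢b
              | charge-a O a≢b (in-list O↭ x∈) (in-list O↭ b∈)
              | charge-a E a≢b (in-list E↭ x∈) (in-list E↭ b∈)
              | charge-a P a≢b (in-list P↭ x∈) (in-list P↭ b∈)
              | before-serve {b = b} (moves 1ℙ h x) (distinct-↭ O↭) (in-list O↭ x∈) (a≢b ∘ sym)
              | before-serve {b = b} (moves 0ℙ h x) (distinct-↭ E↭) (in-list E↭ x∈) (a≢b ∘ sym)
              | moves-0ℙ h x | moves-same 1ℙ h x | moves-other 1ℙ h (a≢b ∘ sym)
        = request-a (before x b O) _ _ _ (moves 1ℙ h x) _ (before-forward (a≢b ∘ sym) j P j≤)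
      by-cases (no a≢b) (no x≢a) (yes refl)
        rewrite Φ-off {O} {E} {P} {h} a≢b | Φ-off {O′} {E′} {P′} {x ∷ h} a≢b
              | charge-b O x≢a | charge-b E x≢a | charge-b P x≢a
              | before-serve′ (moves 1ℙ h x) (distinct-↭ O↭) (in-list O↭ x∈) (in-list O↭ a∈) a≢b
              | before-serve′ (moves 0ℙ h x) (distinct-↭ E↭) (in-list E↭ x∈) (in-list E↭ a∈) a≢b
              | moves-0ℙ h x | moves-same 1ℙ h x | moves-other 1ℙ h a≢b
        = request-b (before a x O) _ _ _ _ (moves 1ℙ h x) backward
        where
        -- Here `x` is the second item of the pair, so `before-forward` is read through
        -- antisymmetry.
        backward : before a x P ≡ false → before a x P′ ≡ false
        backward e = trans (before-antisym x≢a (in-list P′↭ x∈) (in-list P′↭ a∈))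
          (cong not (before-forward a≢b j P j≤
            (trans (before-antisym a≢b (in-list P↭ a∈) (in-list P↭ x∈)) (cong not e))))
      by-cases (no a≢b) (no x≢a) (no x≢b)
        rewrite Φ-off {O} {E} {P} {h} a≢b | Φ-off {O′} {E′} {P′} {x ∷ h} a≢b
              | charge-neither O x≢a x≢b | charge-neither E x≢a x≢b | charge-neither P x≢a x≢b
              | before-moveTo (target (moves 1ℙ h x) x O) (x≢a ∘ sym) (x≢b ∘ sym) O
              | before-moveTo (target (moves 0ℙ h x) x E) (x≢a ∘ sym) (x≢b ∘ sym) E
              | before-moveTo j (x≢a ∘ sym) (x≢b ∘ sym) P
              | moves-other 1ℙ h (x≢a ∘ sym) | moves-other 1ℙ h (x≢b ∘ sym)
        = ℕ.≤-refl

    -- The 8 is 4 for each of the ordered pairs `(u , v)` and `(v , u)`, which `δ` marks; all other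
    -- pairs keep their potential.
    exchange-ΣΣ : ∀ {O E P} h i → suc i ℕ.< length P →
                  ΣΣ (Φ O E (swapAt i P) h) ℕ.≤ 8 ℕ.+ ΣΣ (Φ O E P h)
    exchange-ΣΣ {O} {E} {P} h i i< with before-swapAt i P i<
    ... | u , v , same = begin
      ΣΣ (Φ O E (swapAt i P) h)
        ≤⟨ ΣΣ-mono (λ {a} {b} _ _ → pair a b (a ≟ᴬ b) (same a b)) ⟩
      ΣΣ (λ a b → 4 ℕ.* (δ u v a b ℕ.+ δ v u a b) ℕ.+ Φ O E P h a b)
        ≡⟨ ΣΣ-+ (λ a b → 4 ℕ.* (δ u v a b ℕ.+ δ v u a b)) _ ⟩
      ΣΣ (λ a b → 4 ℕ.* (δ u v a b ℕ.+ δ v u a b)) ℕ.+ ΣΣ (Φ O E P h)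
        ≡⟨ cong (ℕ._+ ΣΣ (Φ O E P h))
             (trans (ΣΣ-* 4 _) (cong (4 ℕ.*_) (ΣΣ-+ (δ u v) (δ v u)))) ⟩
      4 ℕ.* (ΣΣ (δ u v) ℕ.+ ΣΣ (δ v u)) ℕ.+ ΣΣ (Φ O E P h)
        ≤⟨ ℕ.+-monoˡ-≤ _ (ℕ.*-monoʳ-≤ 4 (ℕ.+-mono-≤ (ΣΣ-δ u v) (ΣΣ-δ v u))) ⟩
      8 ℕ.+ ΣΣ (Φ O E P h)
        ∎
      where
      open ℕ.≤-Reasoning
      δ : A → A → A → A → ℕ
      δ u v a b = if does (u ≟ᴬ a) then (if does (v ≟ᴬ b) then 1 else 0) else 0
      δ-hit : ∀ u v → δ u v u v ≡ 1
      δ-hit u v rewrite dec-true (u ≟ᴬ u) refl | dec-true (v ≟ᴬ v) refl = refl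
      Φ-≤ : ∀ a b → Φ O E (swapAt i P) h a b ℕ.≤ 4
      Φ-≤ a b with does (a ≟ᴬ b)
      ... | true  = z≤n
      ... | false = φ-≤ (before a b O) _ _ _ _
      pay : ∀ a b {m n} → 1 ℕ.≤ m → Φ O E (swapAt i P) h a b ℕ.≤ 4 ℕ.* m ℕ.+ n
      pay a b 1≤m =
        ℕ.≤-trans (Φ-≤ a b) (ℕ.≤-trans (ℕ.*-monoʳ-≤ 4 1≤m) (ℕ.m≤m+n _ _))
      pair : ∀ a b → Dec (a ≡ b) →
        before a b (swapAt i P) ≡ before a b P ⊎ (u ≡ a × v ≡ b) ⊎ (v ≡ a × u ≡ b) →
        Φ O E (swapAt i P) h a b ℕ.≤ 4 ℕ.* (δ u v a b ℕ.+ δ v u a b) ℕ.+ Φ O E P h a b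
      pair a b (yes refl) _ rewrite Φ-diagonal O E (swapAt i P) h a = z≤n
      pair a b (no a≢b) (inj₁ e)
        rewrite Φ-off {O} {E} {swapAt i P} {h} a≢b | Φ-off {O} {E} {P} {h} a≢b | e
        = ℕ.m≤n+m _ _
      pair a b _ (inj₂ (inj₁ (refl , refl))) = pay a b
        (ℕ.≤-trans (ℕ.≤-reflexive (sym (δ-hit a b))) (ℕ.m≤m+n _ _))
      pair a b _ (inj₂ (inj₂ (refl , refl))) = pay a b
        (ℕ.≤-trans (ℕ.≤-reflexive (sym (δ-hit a b))) (ℕ.m≤n+m _ (δ b a a b)))

    access-ΣΣ : ∀ {O E P h x} j → O ↭ L → E ↭ L → P ↭ L → x ∈ L → j ℕ.≤ index x P →
      (2 ℕ.* index x O ℕ.+ 2 ℕ.* index x E) ℕ.+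
        ΣΣ (Φ (serve (moves 1ℙ h x) x O) (serve (moves 0ℙ h x) x E) (moveTo j x P) (x ∷ h))
      ℕ.≤ 4 ℕ.* (2 ℕ.* index x P) ℕ.+ ΣΣ (Φ O E P h)
    access-ΣΣ {O} {E} {P} {h} {x} j O↭ E↭ P↭ x∈ j≤ = begin
      (2 ℕ.* index x O ℕ.+ 2 ℕ.* index x E) ℕ.+ ΣΣ Φ′
        ≡⟨ cong (ℕ._+ ΣΣ Φ′) (cong₂ ℕ._+_ (ΣΣ-charge O↭ x∈) (ΣΣ-charge E↭ x∈)) ⟨
      (ΣΣ (charge x O) ℕ.+ ΣΣ (charge x E)) ℕ.+ ΣΣ Φ′
        ≡⟨ cong (ℕ._+ ΣΣ Φ′) (ΣΣ-+ (charge x O) _) ⟨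
      ΣΣ (λ a b → charge x O a b ℕ.+ charge x E a b) ℕ.+ ΣΣ Φ′
        ≡⟨ ΣΣ-+ (λ a b → charge x O a b ℕ.+ charge x E a b) _ ⟨
      ΣΣ (λ a b → (charge x O a b ℕ.+ charge x E a b) ℕ.+ Φ′ a b)
        ≤⟨ ΣΣ-mono (access-pair {h = h} j O↭ E↭ P↭ x∈ j≤) ⟩
      ΣΣ (λ a b → 4 ℕ.* charge x P a b ℕ.+ Φ O E P h a b)
        ≡⟨ ΣΣ-+ (λ a b → 4 ℕ.* charge x P a b) _ ⟩
      ΣΣ (λ a b → 4 ℕ.* charge x P a b) ℕ.+ ΣΣ (Φ O E P h)
        ≡⟨ cong (ℕ._+ ΣΣ (Φ O E P h))
             (trans (ΣΣ-* 4 (charge x P)) (cong (4 ℕ.*_) (ΣΣ-charge P↭ x∈))) ⟩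
      4 ℕ.* (2 ℕ.* index x P) ℕ.+ ΣΣ (Φ O E P h)
        ∎
      where
      open ℕ.≤-Reasoning
      Φ′ : A → A → ℕ
      Φ′ = Φ (serve (moves 1ℙ h x) x O) (serve (moves 0ℙ h x) x E) (moveTo j x P) (x ∷ h)

    -- Summing over ordered pairs counts every position twice, so the pairwise factor 4 appears as 2
    -- against 8.
    amortized : ∀ {P σ} (s : Schedule P σ) h O E → O ↭ L → E ↭ L → P ↭ L → All (_∈ L) σ →
      2 ℕ.* (cost (mtf 1ℙ h O σ) ℕ.+ cost (mtf 0ℙ h E σ)) ℕ.≤ 8 ℕ.* cost s ℕ.+ ΣΣ (Φ O E P h)
    amortized done h O E O↭ E↭ P↭ σ∈ = z≤n
    amortized {P} {σ} (exchange i i< s) h O E O↭ E↭ P↭ σ∈ = begin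
      2 ℕ.* (cost (mtf 1ℙ h O σ) ℕ.+ cost (mtf 0ℙ h E σ))
        ≤⟨ amortized s h O E O↭ E↭ (↭-trans (swapAt-↭ i P) P↭) σ∈ ⟩
      8 ℕ.* cost s ℕ.+ ΣΣ (Φ O E (swapAt i P) h)
        ≤⟨ ℕ.+-monoʳ-≤ (8 ℕ.* cost s) (exchange-ΣΣ {O} {E} {P} h i i<) ⟩
      8 ℕ.* cost s ℕ.+ (8 ℕ.+ ΣΣ (Φ O E P h))
        ≡⟨ solve 2 (λ c f → con 8 :* c :+ (con 8 :+ f) := con 8 :* (con 1 :+ c) :+ f) refl
             (cost s) (ΣΣ (Φ O E P h)) ⟩
      8 ℕ.* suc (cost s) ℕ.+ ΣΣ (Φ O E P h)
        ∎
      where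
      open ℕ.≤-Reasoning
      open +-*-Solver
    amortized {P} {x ∷ σ} (access j j≤ s) h O E O↭ E↭ P↭ (x∈ ∷ σ∈) = begin
      2 ℕ.* (cost (mtf 1ℙ h O (x ∷ σ)) ℕ.+ cost (mtf 0ℙ h E (x ∷ σ)))
        ≡⟨ cong (2 ℕ.*_) (cong₂ ℕ._+_ (mtf-step 1ℙ h O x σ) (mtf-step 0ℙ h E x σ)) ⟩
      2 ℕ.* (suc (index x O ℕ.+ o) ℕ.+ suc (index x E ℕ.+ e))
        ≡⟨ solve 4 (λ i j o e → con 2 :* ((con 1 :+ (i :+ o)) :+ (con 1 :+ (j :+ e))) :=
             con 4 :+ ((con 2 :* i :+ con 2 :* j) :+ con 2 :* (o :+ e))) refl
             (index x O) (index x E) o e ⟩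
      4 ℕ.+ ((2 ℕ.* index x O ℕ.+ 2 ℕ.* index x E) ℕ.+ 2 ℕ.* (o ℕ.+ e))
        ≤⟨ ℕ.+-monoʳ-≤ 4 (ℕ.+-monoʳ-≤ (2 ℕ.* index x O ℕ.+ 2 ℕ.* index x E)
             (amortized s (x ∷ h) O′ E′ (keep (moves 1ℙ h x) O↭) (keep (moves 0ℙ h x) E↭)
               (↭-trans (moveTo-↭ j (distinct-↭ P↭) (in-list P↭ x∈)) P↭) σ∈)) ⟩
      4 ℕ.+ ((2 ℕ.* index x O ℕ.+ 2 ℕ.* index x E) ℕ.+ (8 ℕ.* cost s ℕ.+ ΣΣ Φ′))
        ≡⟨ solve 3 (λ i c f → con 4 :+ (i :+ (con 8 :* c :+ f)) :=
             con 4 :+ con 8 :* c :+ (i :+ f)) refl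
             (2 ℕ.* index x O ℕ.+ 2 ℕ.* index x E) (cost s) (ΣΣ Φ′) ⟩
      4 ℕ.+ 8 ℕ.* cost s ℕ.+ ((2 ℕ.* index x O ℕ.+ 2 ℕ.* index x E) ℕ.+ ΣΣ Φ′)
        -- The extra 1 per access in the full cost model gives 4 for the two online algorithms
        -- together and 8 for the offline one.
        ≤⟨ ℕ.+-mono-≤ (ℕ.+-monoˡ-≤ (8 ℕ.* cost s) (ℕ.m≤m+n 4 4))
             (access-ΣΣ {O} {E} {P} {h} j O↭ E↭ P↭ x∈ j≤) ⟩
      8 ℕ.+ 8 ℕ.* cost s ℕ.+ (4 ℕ.* (2 ℕ.* index x P) ℕ.+ ΣΣ (Φ O E P h))
        ≡⟨ solve 3 (λ i c f → con 8 :+ con 8 :* c :+ (con 4 :* (con 2 :* i) :+ f) :=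
             con 8 :* (con 1 :+ (i :+ c)) :+ f) refl
             (index x P) (cost s) (ΣΣ (Φ O E P h)) ⟩
      8 ℕ.* suc (index x P ℕ.+ cost s) ℕ.+ ΣΣ (Φ O E P h)
        ∎
      where
      open ℕ.≤-Reasoning
      open +-*-Solver
      O′ E′ : List A
      O′ = serve (moves 1ℙ h x) x O
      E′ = serve (moves 0ℙ h x) x E
      o e : ℕ
      o = cost (mtf 1ℙ (x ∷ h) O′ σ)
      e = cost (mtf 0ℙ (x ∷ h) E′ σ)
      Φ′ : A → A → ℕ
      Φ′ = Φ O′ E′ (moveTo j x P) (x ∷ h)
      keep : ∀ {l} β → l ↭ L → serve β x l ↭ L
      keep β l↭ = ↭-trans (serve-↭ β (distinct-↭ l↭) (in-list l↭ x∈)) l↭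

    Φ-start : ∀ a b → Φ L L L [] a b ≡ 0
    Φ-start a b with does (a ≟ᴬ b)
    ... | true  = refl
    ... | false = φ-agree (before a b L) _ _

    -- The minimum is at most the average, and the potential starts at 0 because the three lists
    -- agree.
    min-≤-2cost : ∀ {σ} → All (_∈ L) σ → (s : Schedule L σ) →
      cost (mtf 1ℙ [] L σ) ℕ.⊓ cost (mtf 0ℙ [] L σ) ℕ.≤ 2 ℕ.* cost s
    min-≤-2cost {σ} σ∈ s = ℕ.*-cancelˡ-≤ 4 (begin
      4 ℕ.* (o ℕ.⊓ e)
        ≡⟨ solve 1 (λ m → con 4 :* m := con 2 :* (m :+ m)) refl (o ℕ.⊓ e) ⟩
      2 ℕ.* (o ℕ.⊓ e ℕ.+ o ℕ.⊓ e)
        ≤⟨ ℕ.*-monoʳ-≤ 2 (ℕ.+-mono-≤ (ℕ.m⊓n≤m o e) (ℕ.m⊓n≤n o e)) ⟩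
      2 ℕ.* (o ℕ.+ e)
        ≤⟨ amortized s [] L L ↭-refl ↭-refl ↭-refl σ∈ ⟩
      8 ℕ.* cost s ℕ.+ ΣΣ (Φ L L L [])
        ≡⟨ cong (8 ℕ.* cost s ℕ.+_)
             (trans (Σ-cong L λ {a} _ → trans (Σ-cong L λ {b} _ → Φ-start a b) (Σ-0 L)) (Σ-0 L)) ⟩
      8 ℕ.* cost s ℕ.+ 0
        ≡⟨ solve 1 (λ c → con 8 :* c :+ con 0 := con 4 :* (con 2 :* c)) refl (cost s) ⟩
      4 ℕ.* (2 ℕ.* cost s)
        ∎)
      where
      open ℕ.≤-Reasoning
      open +-*-Solver
      o e : ℕ
      o = cost (mtf 1ℙ [] L σ)
      e = cost (mtf 0ℙ [] L σ)

MTFO⊓MTFE≤2OPT : ∀ (I : Instance) → MTFO I ℕ.⊓ MTFE I ℕ.≤ 2 ℕ.* OPT I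
MTFO⊓MTFE≤2OPT I = min-≤-2cost distinct available
  (proj₁ (ListUpdate.optimal _≟ᴵ_ initial requests))
  where
  open Instance I
  open Upper _≟ᴵ_

-- Lower bound: costs of the passes.

rise : ℕ → ℕ → ℕ
rise k zero    = 0
rise k (suc n) = suc k ℕ.+ rise (suc k) n

-- The arithmetic series of accesses at positions `k + 1` to `k + n`, counted from 1; it is doubled
-- to avoid division.
2*rise : ∀ k n → 2 ℕ.* rise k n ≡ n ℕ.* (2 ℕ.* k ℕ.+ suc n)
2*rise k zero    = refl
2*rise k (suc n) rewrite ℕ.*-distribˡ-+ 2 (suc k) (rise (suc k) n) | 2*rise (suc k) n =
  solve 2 (λ k n → con 2 :* (con 1 :+ k) :+ n :* (con 2 :* (con 1 :+ k) :+ (con 1 :+ n)) :=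
    (con 1 :+ n) :* (con 2 :* k :+ (con 2 :+ n))) refl k n
  where open +-*-Solver

module Lower {A : Set} (_≟ᴬ_ : DecidableEquality A) where
  open ListUpdate _≟ᴬ_
  open Lists _≟ᴬ_

  index-mid : ∀ {x} w {v} → Unique (w ++ x ∷ v) → index x (w ++ x ∷ v) ≡ length w
  index-mid {x} [] _ rewrite dec-true (x ≟ᴬ x) refl = refl
  index-mid {x} (y ∷ w) (y∉ ∷ u!)
    rewrite dec-false (x ≟ᴬ y) (λ x≡y → All.head (All.++⁻ʳ w y∉) (sym x≡y))
    = cong suc (index-mid w u!)

  others-mid : ∀ {x} w {v} → Unique (w ++ x ∷ v) → others x (w ++ x ∷ v) ≡ w ++ v
  others-mid {x} [] (x∉ ∷ _) rewrite dec-true (x ≟ᴬ x) refl = others-all x∉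
  others-mid {x} (y ∷ w) (y∉ ∷ u!)
    rewrite dec-false (x ≟ᴬ y) (λ x≡y → All.head (All.++⁻ʳ w y∉) (sym x≡y))
    = cong (y ∷_) (others-mid w u!)

  ∈-mid : ∀ {x : A} w {v} → x ∈ w ++ x ∷ v
  ∈-mid []      = here refl
  ∈-mid (y ∷ w) = there (∈-mid w)

  -- Driving a schedule by a list of move-or-stay decisions lets MTFO, MTFE and the offline
  -- algorithm share the lemmas on passes. Once the list is exhausted, items stay.
  run : List Bool → ∀ l σ → Schedule l σ
  run _        l []      = done
  run []       l (x ∷ σ) = access (index x l) ℕ.≤-refl (run [] _ σ)
  run (β ∷ bs) l (x ∷ σ) = access (target β x l) (target≤ β x l) (run bs _ σ)

  runCost : List Bool → (l σ : List A) → ℕ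
  runCost bs l σ = cost (run bs l σ)

  decisions : Parity → (h σ : List A) → List Bool
  decisions p h []      = []
  decisions p h (x ∷ σ) = moves p h x ∷ decisions p (x ∷ h) σ

  mtf-run : ∀ p h l σ → cost (mtf p h l σ) ≡ runCost (decisions p h σ) l σ
  mtf-run p h l []      = refl
  mtf-run p h l (x ∷ σ) =
    trans (mtf-step p h l x σ) (cong (suc (index x l) ℕ.+_) (mtf-run p (x ∷ h) _ σ))

  run-stay : ∀ {x} bs σ w {v} → Unique (w ++ x ∷ v) →
             runCost (false ∷ bs) (w ++ x ∷ v) (x ∷ σ) ≡
             suc (length w) ℕ.+ runCost bs (w ++ x ∷ v) σ
  run-stay bs σ w u! = cong₂ (λ i l → suc i ℕ.+ runCost bs l σ)
    (index-mid w u!) (moveTo-index u! (∈-mid w))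

  run-move : ∀ {x} bs σ w {v} → Unique (w ++ x ∷ v) →
             runCost (true ∷ bs) (w ++ x ∷ v) (x ∷ σ) ≡
             suc (length w) ℕ.+ runCost bs (x ∷ w ++ v) σ
  run-move {x} bs σ w u! = cong₂ (λ i l → suc i ℕ.+ runCost bs (x ∷ l) σ)
    (index-mid w u!) (others-mid w u!)

  pairs : ∀ {B : Set} → B → B → List A → List B
  pairs β γ = concatMap (const (β ∷ γ ∷ []))

  doubles : List A → List A
  doubles = concatMap (λ x → x ∷ x ∷ [])

  singles : Bool → List A → List Bool
  singles β = map (const β)

  module _ (bs : List Bool) (σ : List A) where
    open +-*-Solver

    -- The requested prefix is kept reversed in `u`, since `u ʳ++ x ∷ v` and `(x ∷ u) ʳ++ v` are
    -- equal by definition and the list need not be rearranged in the induction.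
    stay-pass : ∀ u v → Unique (u ʳ++ v) →
      runCost (singles false v ++ bs) (u ʳ++ v) (v ++ σ) ≡
      rise (length u) (length v) ℕ.+ runCost bs (u ʳ++ v) σ
    stay-pass u []      u! = refl
    stay-pass u (x ∷ v) u! = begin
      runCost (false ∷ singles false v ++ bs) (u ʳ++ x ∷ v) (x ∷ v ++ σ)
        ≡⟨ cong (λ l → runCost (false ∷ singles false v ++ bs) l (x ∷ v ++ σ)) (ʳ++-defn u) ⟩
      runCost (false ∷ singles false v ++ bs) (reverse u ++ x ∷ v) (x ∷ v ++ σ)
        ≡⟨ run-stay (singles false v ++ bs) (v ++ σ) (reverse u) (subst Unique (ʳ++-defn u) u!) ⟩
      suc (length (reverse u)) ℕ.+ runCost (singles false v ++ bs) (reverse u ++ x ∷ v) (v ++ σ)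
        ≡⟨ cong₂ (λ n l → suc n ℕ.+ runCost (singles false v ++ bs) l (v ++ σ))
             (length-reverse u) (sym (ʳ++-defn u)) ⟩
      suc (length u) ℕ.+ runCost (singles false v ++ bs) (u ʳ++ x ∷ v) (v ++ σ)
        ≡⟨ cong (suc (length u) ℕ.+_) (stay-pass (x ∷ u) v u!) ⟩
      suc (length u) ℕ.+ (rise (suc (length u)) (length v) ℕ.+ runCost bs (u ʳ++ x ∷ v) σ)
        ≡⟨ ℕ.+-assoc (suc (length u)) _ _ ⟨
      rise (length u) (suc (length v)) ℕ.+ runCost bs (u ʳ++ x ∷ v) σ
        ∎
      where open ≡-Reasoning

    -- Requested items pile up in `w` at the front, latest first, while `v` keeps its order; so the
    -- next item always stands right behind `w`.
    move-pass : ∀ w v → Unique (w ++ v) →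
      runCost (singles true v ++ bs) (w ++ v) (v ++ σ) ≡
      rise (length w) (length v) ℕ.+ runCost bs (v ʳ++ w) σ
    move-pass w []      u! rewrite ++-identityʳ w = refl
    move-pass w (x ∷ v) u! = begin
      runCost (true ∷ singles true v ++ bs) (w ++ x ∷ v) (x ∷ v ++ σ)
        ≡⟨ run-move (singles true v ++ bs) (v ++ σ) w u! ⟩
      suc (length w) ℕ.+ runCost (singles true v ++ bs) (x ∷ w ++ v) (v ++ σ)
        ≡⟨ cong (suc (length w) ℕ.+_) (move-pass (x ∷ w) v (Unique-↭ (shift x w v) u!)) ⟩
      suc (length w) ℕ.+ (rise (suc (length w)) (length v) ℕ.+ runCost bs (v ʳ++ x ∷ w) σ)
        ≡⟨ ℕ.+-assoc (suc (length w)) _ _ ⟨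
      rise (length w) (suc (length v)) ℕ.+ runCost bs (v ʳ++ x ∷ w) σ
        ∎
      where open ≡-Reasoning

    -- As in `move-pass`, except that each second request finds its item at the front and costs 1.
    move-stay-pass : ∀ w v → Unique (w ++ v) →
      runCost (pairs true false v ++ bs) (w ++ v) (doubles v ++ σ) ≡
      (rise (length w) (length v) ℕ.+ length v) ℕ.+ runCost bs (v ʳ++ w) σ
    move-stay-pass w []      u! rewrite ++-identityʳ w = refl
    move-stay-pass w (x ∷ v) u! = begin
      runCost (true ∷ false ∷ bs′) (w ++ x ∷ v) (x ∷ x ∷ σ′)
        ≡⟨ run-move (false ∷ bs′) (x ∷ σ′) w u! ⟩
      suc (length w) ℕ.+ runCost (false ∷ bs′) (x ∷ w ++ v) (x ∷ σ′)
        ≡⟨ cong (suc (length w) ℕ.+_) (run-stay bs′ σ′ [] u!′) ⟩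
      suc (length w) ℕ.+ suc (runCost bs′ (x ∷ w ++ v) σ′)
        ≡⟨ cong (λ c → suc (length w) ℕ.+ suc c) (move-stay-pass (x ∷ w) v u!′) ⟩
      suc (length w) ℕ.+ suc ((r ℕ.+ length v) ℕ.+ c)
        ≡⟨ solve 4 (λ w r v c → w :+ (con 1 :+ ((r :+ v) :+ c)) :=
             ((w :+ r) :+ (con 1 :+ v)) :+ c) refl (suc (length w)) r (length v) c ⟩
      (suc (length w) ℕ.+ r ℕ.+ suc (length v)) ℕ.+ c
        ∎
      where
      open ≡-Reasoning
      bs′ = pairs true false v ++ bs
      σ′  = doubles v ++ σ
      u!′ = Unique-↭ (shift x w v) u!
      r   = rise (suc (length w)) (length v)
      c   = runCost bs (v ʳ++ x ∷ w) σ

    -- Each request goes to the last item of the list.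
    stay-move-pass : ∀ w v → Unique (w ++ reverse v) →
      runCost (pairs false true v ++ bs) (w ++ reverse v) (doubles v ++ σ) ≡
      length v ℕ.* (2 ℕ.* (length w ℕ.+ length v)) ℕ.+ runCost bs (v ʳ++ w) σ
    stay-move-pass w []      u! rewrite ++-identityʳ w = refl
    stay-move-pass w (x ∷ v) u! = begin
      runCost (false ∷ true ∷ bs′) (w ++ reverse (x ∷ v)) (x ∷ x ∷ σ′)
        ≡⟨ cong (λ l → runCost (false ∷ true ∷ bs′) l (x ∷ x ∷ σ′)) last ⟩
      runCost (false ∷ true ∷ bs′) (w′ ++ x ∷ []) (x ∷ x ∷ σ′)
        ≡⟨ run-stay (true ∷ bs′) (x ∷ σ′) w′ u!′ ⟩
      suc (length w′) ℕ.+ runCost (true ∷ bs′) (w′ ++ x ∷ []) (x ∷ σ′)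
        ≡⟨ cong (suc (length w′) ℕ.+_) (run-move bs′ σ′ w′ u!′) ⟩
      suc (length w′) ℕ.+ (suc (length w′) ℕ.+ runCost bs′ (x ∷ w′ ++ []) σ′)
        ≡⟨ cong₂ (λ n l → suc n ℕ.+ (suc n ℕ.+ runCost bs′ (x ∷ l) σ′))
             (trans (length-++ w) (cong (length w ℕ.+_) (length-reverse v))) (++-identityʳ w′) ⟩
      suc (a ℕ.+ b) ℕ.+ (suc (a ℕ.+ b) ℕ.+ runCost bs′ (x ∷ w ++ reverse v) σ′)
        ≡⟨ cong (λ c → suc (a ℕ.+ b) ℕ.+ (suc (a ℕ.+ b) ℕ.+ c)) (stay-move-pass (x ∷ w) v
             (subst (Unique ∘ (x ∷_)) (++-identityʳ w′) (Unique-↭ (shift x w′ []) u!′))) ⟩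
      suc (a ℕ.+ b) ℕ.+ (suc (a ℕ.+ b) ℕ.+ (b ℕ.* (2 ℕ.* (suc a ℕ.+ b)) ℕ.+ c))
        ≡⟨ solve 3 (λ a b c → (con 1 :+ (a :+ b)) :+ ((con 1 :+ (a :+ b)) :+
               (b :* (con 2 :* (con 1 :+ a :+ b)) :+ c)) :=
             (con 1 :+ b) :* (con 2 :* (a :+ (con 1 :+ b))) :+ c) refl a b c ⟩
      suc b ℕ.* (2 ℕ.* (a ℕ.+ suc b)) ℕ.+ c
        ∎
      where
      open ≡-Reasoning
      bs′ = pairs false true v ++ bs
      σ′  = doubles v ++ σ
      w′  = w ++ reverse v
      last : w ++ reverse (x ∷ v) ≡ w′ ++ x ∷ []
      last = trans (cong (w ++_) (unfold-reverse x v)) (sym (++-assoc w (reverse v) _))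
      u!′ = subst Unique last u!
      a   = length w
      b   = length v
      c   = runCost bs (v ʳ++ x ∷ w) σ

  half : List A → List A
  half l = l ++ doubles l

  -- β tells whether the algorithm moves at the first request to each item.
  halfDecisions : Bool → List A → List Bool
  halfDecisions β l = singles β l ++ pairs (not β) β l

  -- With `true`, the doubled part consists of `2 * n` requests at position `n`. With `false`, it is
  -- again a rising pass, with `n` accesses to the front added.
  halfCost : Bool → ℕ → ℕ
  halfCost true  n = rise 0 n ℕ.+ n ℕ.* (2 ℕ.* n)
  halfCost false n = rise 0 n ℕ.+ (rise 0 n ℕ.+ n)

  reverse-! : ∀ {l : List A} → Unique l → Unique (reverse l)
  reverse-! {l} = Unique-↭ (↭-sym (↭-reverse l))

  -- In both cases the doubled part moves every item to the front once, in the order of `l`, so the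
  -- final list is `reverse l` whatever the first pass did.
  run-half : ∀ β bs {l} σ → Unique l → runCost (halfDecisions β l ++ bs) l (half l ++ σ) ≡
             halfCost β (length l) ℕ.+ runCost bs (reverse l) σ
  run-half true bs {l} σ l!
    rewrite ++-assoc (singles true l) (pairs false true l) bs | ++-assoc l (doubles l) σ =
    trans (move-pass (pairs false true l ++ bs) (doubles l ++ σ) [] l l!)
      (trans (cong (rise 0 (length l) ℕ.+_) (stay-move-pass bs σ [] l (reverse-! l!)))
        (sym (ℕ.+-assoc (rise 0 (length l)) _ _)))
  run-half false bs {l} σ l!
    rewrite ++-assoc (singles false l) (pairs true false l) bs | ++-assoc l (doubles l) σ =
    trans (stay-pass (pairs true false l ++ bs) (doubles l ++ σ) [] l l!)
      (trans (cong (rise 0 (length l) ℕ.+_) (move-stay-pass bs σ [] l l!))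
        (sym (ℕ.+-assoc (rise 0 (length l)) _ _)))

  -- Parities and decisions along the request sequence.

  moves-absent : ∀ p h v {y} → All (y ≢_) v → moves p (v ʳ++ h) y ≡ moves p h y
  moves-absent p h []      []          = refl
  moves-absent p h (x ∷ v) (y≢x ∷ y∉v) =
    trans (moves-absent p (x ∷ h) v y∉v) (moves-other p h y≢x)

  moves-pass : ∀ p h {v y} → Unique v → y ∈ v → moves p (v ʳ++ h) y ≡ not (moves p h y)
  moves-pass p h {x ∷ v} (x∉v ∷ v!) (here refl) =
    trans (moves-absent p (x ∷ h) v x∉v) (moves-same p h x)
  moves-pass p h {x ∷ v} (x∉v ∷ v!) (there y∈v) =
    trans (moves-pass p (x ∷ h) v! y∈v)
      (cong not (moves-other p h (All.lookup x∉v y∈v ∘ sym)))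

  moves-twice : ∀ p h x y → moves p (x ∷ x ∷ h) y ≡ moves p h y
  moves-twice p h x y = by-cases (y ≟ᴬ x)
    where
    by-cases : Dec (y ≡ x) → moves p (x ∷ x ∷ h) y ≡ moves p h y
    by-cases (yes refl) = trans (moves-same p (x ∷ h) x)
      (trans (cong not (moves-same p h x)) (Bool.not-involutive _))
    by-cases (no y≢x)   = trans (moves-other p (x ∷ h) y≢x) (moves-other p h y≢x)

  moves-doubles : ∀ p h v y → moves p (doubles v ʳ++ h) y ≡ moves p h y
  moves-doubles p h []      y = refl
  moves-doubles p h (x ∷ v) y =
    trans (moves-doubles p (x ∷ x ∷ h) v y) (moves-twice p h x y)

  decisions-pass : ∀ {p h β v σ} → Unique v → (∀ {x} → x ∈ v → moves p h x ≡ β) →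
    decisions p h (v ++ σ) ≡ singles β v ++ decisions p (v ʳ++ h) σ
  decisions-pass [] _ = refl
  decisions-pass {p} {h} (x∉v ∷ v!) β≡ = cong₂ _∷_ (β≡ (here refl))
    (decisions-pass v! λ y∈v →
      trans (moves-other p h (All.lookup x∉v y∈v ∘ sym)) (β≡ (there y∈v)))

  decisions-doubles : ∀ {p h β v σ} → Unique v → (∀ {x} → x ∈ v → moves p h x ≡ β) →
    decisions p h (doubles v ++ σ) ≡ pairs β (not β) v ++ decisions p (doubles v ʳ++ h) σ
  decisions-doubles [] _ = refl
  decisions-doubles {p} {h} {v = x ∷ v} (x∉v ∷ v!) β≡ =
    cong₂ _∷_ (β≡ (here refl)) (cong₂ _∷_
      (trans (moves-same p h x) (cong not (β≡ (here refl))))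
      (decisions-doubles v! λ {y} y∈v → trans (moves-twice p h x y) (β≡ (there y∈v))))

  after : List A → List A → List A
  after l h = doubles l ʳ++ l ʳ++ h

  -- Each item has been requested three times, an odd number, which makes MTFO and MTFE swap roles.
  moves-after : ∀ {p h β l x} → Unique l → moves p h x ≡ β → x ∈ l →
                moves p (after l h) x ≡ not β
  moves-after {p} {h} {l = l} {x} l! β≡ x∈ =
    trans (moves-doubles p (l ʳ++ h) l x) (trans (moves-pass p h l! x∈) (cong not β≡))

  decisions-half : ∀ {p h β l σ} → Unique l → (∀ {x} → x ∈ l → moves p h x ≡ β) →
    decisions p h (half l ++ σ) ≡ halfDecisions β l ++ decisions p (after l h) σ
  decisions-half {p} {h} {β} {l} {σ} l! β≡ = begin
    decisions p h ((l ++ doubles l) ++ σ)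
      ≡⟨ cong (decisions p h) (++-assoc l (doubles l) σ) ⟩
    decisions p h (l ++ doubles l ++ σ)
      ≡⟨ decisions-pass l! β≡ ⟩
    singles β l ++ decisions p (l ʳ++ h) (doubles l ++ σ)
      ≡⟨ cong (singles β l ++_) (decisions-doubles l! λ x∈ →
           trans (moves-pass p h l! x∈) (cong not (β≡ x∈))) ⟩
    singles β l ++ pairs (not β) (not (not β)) l ++ decisions p (after l h) σ
      ≡⟨ cong (λ γ → singles β l ++ pairs (not β) γ l ++ decisions p (after l h) σ) (Bool.not-involutive β) ⟩
    singles β l ++ pairs (not β) β l ++ decisions p (after l h) σ
      ≡⟨ ++-assoc (singles β l) _ _ ⟨
    halfDecisions β l ++ decisions p (after l h) σ
      ∎
    where open ≡-Reasoning

  -- A round reverses the list twice and requests every item six times, so it restores both the list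
  -- and the parities and can be repeated.
  rounds : ℕ → List A → List A
  rounds zero    l = []
  rounds (suc m) l = half l ++ half (reverse l) ++ rounds m l

  run-round : ∀ β γ bs {l} σ → Unique l →
    runCost (halfDecisions β l ++ halfDecisions γ (reverse l) ++ bs) l
            (half l ++ half (reverse l) ++ σ) ≡
    (halfCost β (length l) ℕ.+ halfCost γ (length l)) ℕ.+ runCost bs l σ
  run-round β γ bs {l} σ l! = begin
    runCost (halfDecisions β l ++ halfDecisions γ (reverse l) ++ bs) l
            (half l ++ half (reverse l) ++ σ)
      ≡⟨ run-half β _ _ l! ⟩
    c ℕ.+ runCost (halfDecisions γ (reverse l) ++ bs) (reverse l) (half (reverse l) ++ σ)
      ≡⟨ cong (c ℕ.+_) (run-half γ bs σ (reverse-! l!)) ⟩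
    c ℕ.+ (halfCost γ (length (reverse l)) ℕ.+ runCost bs (reverse (reverse l)) σ)
      ≡⟨ cong₂ (λ n k → c ℕ.+ (halfCost γ n ℕ.+ runCost bs k σ))
           (length-reverse l) (reverse-involutive l) ⟩
    c ℕ.+ (halfCost γ (length l) ℕ.+ runCost bs l σ)
      ≡⟨ ℕ.+-assoc c _ _ ⟨
    (c ℕ.+ halfCost γ (length l)) ℕ.+ runCost bs l σ
      ∎
    where
    open ≡-Reasoning
    c = halfCost β (length l)

  -- That all items share the decision `β` is the invariant: it becomes `not β` after the first half
  -- of a round and `β` again after the second. Each round thus contains one half of either kind.
  mtf-rounds : ∀ m {p h β l} → Unique l → (∀ {x} → x ∈ l → moves p h x ≡ β) →
    runCost (decisions p h (rounds m l)) l (rounds m l) ≡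
    m ℕ.* (halfCost β (length l) ℕ.+ halfCost (not β) (length l))
  mtf-rounds zero                  l! β≡ = refl
  mtf-rounds (suc m) {p} {h} {β} {l} l! β≡ = begin
    runCost (decisions p h (rounds (suc m) l)) l (rounds (suc m) l)
      ≡⟨ cong (λ bs → runCost bs l (rounds (suc m) l)) (trans (decisions-half l! β≡)
           (cong (halfDecisions β l ++_) (decisions-half (reverse-! l!) β≡′))) ⟩
    runCost (halfDecisions β l ++ halfDecisions (not β) (reverse l) ++
             decisions p h″ (rounds m l)) l (rounds (suc m) l)
      ≡⟨ run-round β (not β) _ _ l! ⟩
    c ℕ.+ runCost (decisions p h″ (rounds m l)) l (rounds m l)
      ≡⟨ cong (c ℕ.+_) (mtf-rounds m l! λ x∈ → trans
           (moves-after (reverse-! l!) (β≡′ (turn x∈)) (turn x∈)) (Bool.not-involutive β)) ⟩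
    c ℕ.+ m ℕ.* c
      ∎
    where
    open ≡-Reasoning
    c  = halfCost β (length l) ℕ.+ halfCost (not β) (length l)
    h″ = after (reverse l) (after l h)
    turn : ∀ {x} → x ∈ l → x ∈ reverse l
    turn = ∈-resp-↭ (↭-sym (↭-reverse l))
    β≡′ : ∀ {x} → x ∈ reverse l → moves p (after l h) x ≡ not β
    β≡′ x∈ = moves-after l! (β≡ (∈-resp-↭ (↭-reverse l) x∈)) (∈-resp-↭ (↭-reverse l) x∈)

  -- This follows MTFO and MTFE alternately, in each half the one that begins by staying.
  offline : ℕ → List A → List Bool
  offline zero    l = []
  offline (suc m) l = halfDecisions false l ++ halfDecisions false (reverse l) ++ offline m l

  offline-cost : ∀ m {l} → Unique l → runCost (offline m l) l (rounds m l) ≡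
                 m ℕ.* (halfCost false (length l) ℕ.+ halfCost false (length l))
  offline-cost zero    l! = refl
  offline-cost (suc m) {l} l! = trans (run-round false false _ _ l!)
    (cong (halfCost false (length l) ℕ.+ halfCost false (length l) ℕ.+_) (offline-cost m l!))

  doubles-⊆ : ∀ {x} v → x ∈ doubles v → x ∈ v
  doubles-⊆ (y ∷ v) (here refl)         = here refl
  doubles-⊆ (y ∷ v) (there (here refl)) = here refl
  doubles-⊆ (y ∷ v) (there (there x∈))  = there (doubles-⊆ v x∈)

  half-⊆ : ∀ {x} l → x ∈ half l → x ∈ l
  half-⊆ l x∈ with ∈-++⁻ l x∈
  ... | inj₁ x∈l = x∈l
  ... | inj₂ x∈d = doubles-⊆ l x∈d

  rounds-⊆ : ∀ {x} m l → x ∈ rounds m l → x ∈ l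
  rounds-⊆ (suc m) l x∈ with ∈-++⁻ (half l) x∈
  ... | inj₁ x∈h = half-⊆ l x∈h
  ... | inj₂ x∈r with ∈-++⁻ (half (reverse l)) x∈r
  ...   | inj₁ x∈h = ∈-resp-↭ (↭-reverse l) (half-⊆ (reverse l) x∈h)
  ...   | inj₂ x∈m = rounds-⊆ m l x∈m

open Lower ℕ._≟_

-- The instances for the lower bound.

worst : ℕ → ℕ → Instance
worst n m = record
  { _≟ᴵ_      = ℕ._≟_
  ; initial   = upTo n
  ; distinct  = upTo⁺ n
  ; requests  = rounds m (upTo n)
  ; available = All.tabulate (rounds-⊆ m (upTo n))
  }

MTFO-worst : ∀ n m → MTFO (worst n m) ≡ m ℕ.* (halfCost true n ℕ.+ halfCost false n)
MTFO-worst n m = trans (mtf-run 1ℙ [] (upTo n) (rounds m (upTo n)))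
  (trans (mtf-rounds m (upTo⁺ n) λ _ → refl)
    (cong (λ k → m ℕ.* (halfCost true k ℕ.+ halfCost false k)) (length-upTo n)))

MTFE-worst : ∀ n m → MTFE (worst n m) ≡ m ℕ.* (halfCost false n ℕ.+ halfCost true n)
MTFE-worst n m = trans (mtf-run 0ℙ [] (upTo n) (rounds m (upTo n)))
  (trans (mtf-rounds m (upTo⁺ n) λ _ → refl)
    (cong (λ k → m ℕ.* (halfCost false k ℕ.+ halfCost true k)) (length-upTo n)))

min-worst : ∀ n m → MTFO (worst n m) ℕ.⊓ MTFE (worst n m) ≡
            m ℕ.* (halfCost true n ℕ.+ halfCost false n)
min-worst n m = trans
  (cong₂ ℕ._⊓_ (MTFO-worst n m)
    (trans (MTFE-worst n m) (cong (m ℕ.*_) (ℕ.+-comm (halfCost false n) (halfCost true n)))))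
  (ℕ.⊓-idem _)

OPT-worst : ∀ n m → OPT (worst n m) ℕ.≤ m ℕ.* (halfCost false n ℕ.+ halfCost false n)
OPT-worst n m = ℕ.≤-trans
  (proj₂ (ListUpdate.optimal ℕ._≟_ (upTo n) (rounds m (upTo n)))
    (run (offline m (upTo n)) (upTo n) (rounds m (upTo n))))
  (ℕ.≤-reflexive (trans (offline-cost m (upTo⁺ n))
    (cong (λ k → m ℕ.* (halfCost false k ℕ.+ halfCost false k)) (length-upTo n))))

-- From rational inequalities to natural numbers.

n/1 : ℕ → ℚᵘ
n/1 n = mkℚᵘ (+ n) 0

-- Denominators are at least 1. The additive constant may thus be replaced by a natural number.
b≤∣↥b∣ : ∀ b → toℚᵘ b ℚᵘ.≤ n/1 ℤ.∣ ℚ.↥ b ∣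
b≤∣↥b∣ (mkℚ -[1+ r ] e _) = ℚᵘ.*≤* ℤ.-≤+
b≤∣↥b∣ (mkℚ (+ r)    e _) = ℚᵘ.*≤* (subst₂ ℤ._≤_
  (ℤ.pos-* r 1) (ℤ.pos-* r (suc e)) (ℤ.+≤+ (ℕ.*-monoʳ-≤ r (s≤s z≤n))))

-- (7 k - 1) / (4 k) for k = suc d
7/4-gap : ℕ → ℚᵘ
7/4-gap d = mkℚᵘ (+ (6 ℕ.+ 7 ℕ.* d)) (3 ℕ.+ 4 ℕ.* d)

-- If `c` is `p / k`, then `4 p < 7 k`, and for integers this means `4 p ≤ 7 k - 1`: the denominator
-- alone bounds the distance to 7/4 from below.
c≤7/4-gap : ∀ c → c < + 7 / 4 → toℚᵘ c ℚᵘ.≤ 7/4-gap (ℚ.denominator-1 c)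
c≤7/4-gap (mkℚ -[1+ p ] d _) _ = ℚᵘ.*≤* ℤ.-≤+
c≤7/4-gap (mkℚ (+ p) d _) (ℚ.*<* p<) = ℚᵘ.*≤* (subst₂ ℤ._≤_
  (ℤ.pos-* p (4 ℕ.+ 4 ℕ.* d)) (ℤ.pos-* (6 ℕ.+ 7 ℕ.* d) (suc d)) (ℤ.+≤+ (begin
    p ℕ.* (4 ℕ.+ 4 ℕ.* d)
      ≡⟨ solve 2 (λ p d → p :* (con 4 :+ con 4 :* d) := (p :* con 4) :* (con 1 :+ d)) refl p d ⟩
    (p ℕ.* 4) ℕ.* suc d
      ≤⟨ ℕ.*-monoˡ-≤ (suc d) (ℕ.≤-pred (ℕ.≤-trans 4p<7k (ℕ.≤-reflexive
           (solve 1 (λ d → con 7 :* (con 1 :+ d) := con 1 :+ (con 6 :+ con 7 :* d)) refl d)))) ⟩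
    (6 ℕ.+ 7 ℕ.* d) ℕ.* suc d
      ∎)))
  where
  open ℕ.≤-Reasoning
  open +-*-Solver
  4p<7k : p ℕ.* 4 ℕ.< 7 ℕ.* suc d
  4p<7k = ℤ.drop‿+<+ (subst₂ ℤ._<_ (sym (ℤ.pos-* p 4)) (sym (ℤ.pos-* 7 (suc d))) p<)

affine-< : ∀ p q x k y → p ℕ.* x ℕ.+ k ℕ.* suc q ℕ.< y ℕ.* suc q →
           mkℚᵘ (+ p) q ℚᵘ.* n/1 x ℚᵘ.+ n/1 k ℚᵘ.< n/1 y
affine-< p q x k y lt = ℚᵘ.*<* (subst₂ ℤ._<_ (sym left) (sym right) (ℤ.+<+ lt))
  where
  left : (+ p ℤ.* + x ℤ.* + 1 ℤ.+ + k ℤ.* + (suc q ℕ.* 1)) ℤ.* + 1 ≡ + (p ℕ.* x ℕ.+ k ℕ.* suc q)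
  left = trans (ℤ.*-identityʳ _) (cong₂ ℤ._+_
    (trans (ℤ.*-identityʳ _) (sym (ℤ.pos-* p x)))
    (trans (cong (λ n → + k ℤ.* + n) (ℕ.*-identityʳ (suc q))) (sym (ℤ.pos-* k (suc q)))))
  right : + y ℤ.* + (suc q ℕ.* 1 ℕ.* 1) ≡ + (y ℕ.* suc q)
  right = trans (cong (λ n → + y ℤ.* + n)
      (trans (ℕ.*-identityʳ (suc q ℕ.* 1)) (ℕ.*-identityʳ (suc q))))
    (sym (ℤ.pos-* y (suc q)))

-- The detour through unnormalised rationals avoids reduction to lowest terms, so that the
-- comparison becomes one of cross products.
below : ∀ c b x y → c < + 7 / 4 → let d = ℚ.denominator-1 c in
  (6 ℕ.+ 7 ℕ.* d) ℕ.* x ℕ.+ ℤ.∣ ℚ.↥ b ∣ ℕ.* (4 ℕ.+ 4 ℕ.* d) ℕ.< y ℕ.* (4 ℕ.+ 4 ℕ.* d) →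
  c * (+ x / 1) + b < + y / 1
below c b x y c< lt = ℚ.toℚᵘ-cancel-< (begin-strict
  toℚᵘ (c * (+ x / 1) + b)
    ≃⟨ ℚ.toℚᵘ-homo-+ (c * (+ x / 1)) b ⟩
  toℚᵘ (c * (+ x / 1)) ℚᵘ.+ toℚᵘ b
    ≃⟨ ℚᵘ.+-congˡ (toℚᵘ b) (ℚ.toℚᵘ-homo-* c (+ x / 1)) ⟩
  toℚᵘ c ℚᵘ.* toℚᵘ (+ x / 1) ℚᵘ.+ toℚᵘ b
    ≃⟨ ℚᵘ.+-congˡ (toℚᵘ b) (ℚᵘ.*-congˡ {toℚᵘ c} (ℚ.toℚᵘ-fromℚᵘ (n/1 x))) ⟩
  toℚᵘ c ℚᵘ.* n/1 x ℚᵘ.+ toℚᵘ b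
    ≤⟨ ℚᵘ.+-mono-≤ (ℚᵘ.*-monoˡ-≤-nonNeg (n/1 x) (c≤7/4-gap c c<)) (b≤∣↥b∣ b) ⟩
  7/4-gap d ℚᵘ.* n/1 x ℚᵘ.+ n/1 k
    <⟨ affine-< (6 ℕ.+ 7 ℕ.* d) (3 ℕ.+ 4 ℕ.* d) x k y lt ⟩
  n/1 y
    ≃⟨ ℚ.toℚᵘ-fromℚᵘ (n/1 y) ⟨
  toℚᵘ (+ y / 1)
    ∎)
  where
  open ℚᵘ.≤-Reasoning
  d = ℚ.denominator-1 c
  k = ℤ.∣ ℚ.↥ b ∣

-- Choice of the list length and the number of rounds.

open +-*-Solver

-- The length n and the number m of rounds are chosen so that the linear terms
-- lost against 7/4 are absorbed by the quadratic ones.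
length-choice : ∀ d k n m → n ≡ 10 ℕ.+ 9 ℕ.* d → m ≡ suc (suc d ℕ.* k) →
  (6 ℕ.+ 7 ℕ.* d) ℕ.* (m ℕ.* (2 ℕ.* (n ℕ.* suc n) ℕ.+ 2 ℕ.* n)) ℕ.+ k ℕ.* (4 ℕ.+ 4 ℕ.* d) ℕ.<
  (m ℕ.* (3 ℕ.* (n ℕ.* suc n) ℕ.+ 2 ℕ.* n ℕ.+ 4 ℕ.* (n ℕ.* n))) ℕ.* (2 ℕ.+ 2 ℕ.* d)
length-choice d k _ _ refl refl =
  ℕ.<-≤-trans (ℕ.m<m+n _ ℕ.z<s) (ℕ.≤-reflexive (solve 2 (λ d k →
    -- Per round the right side exceeds the left by `2 n (n + 2 - 9 (d + 1))`, which is `6 n` for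
    -- this `n`. The `m` rounds also absorb `4 (d + 1) k`; the polynomial after `con 1` is what
    -- remains.
    let n = con 10 :+ con 9 :* d; m = con 1 :+ (con 1 :+ d) :* k in
    (con 6 :+ con 7 :* d) :* (m :* (con 2 :* (n :* (con 1 :+ n)) :+ con 2 :* n)) :+
      k :* (con 4 :+ con 4 :* d) :+
      (con 1 :+ (con 59 :+ con 54 :* d :+ (con 1 :+ d) :* k :* (con 56 :+ con 54 :* d))) :=
    (m :* (con 3 :* (n :* (con 1 :+ n)) :+ con 2 :* n :+ con 4 :* (n :* n))) :*
      (con 2 :+ con 2 :* d))
    refl d k))

-- A factor 2 is taken from `4 + 4 d` into the cost of a round, so that only the double of the
-- triangular number `T` occurs and `2*rise` applies.
gap : ∀ d k n m x → n ≡ 10 ℕ.+ 9 ℕ.* d → m ≡ suc (suc d ℕ.* k) →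
  x ℕ.≤ m ℕ.* (halfCost false n ℕ.+ halfCost false n) →
  (6 ℕ.+ 7 ℕ.* d) ℕ.* x ℕ.+ k ℕ.* (4 ℕ.+ 4 ℕ.* d) ℕ.<
  (m ℕ.* (halfCost true n ℕ.+ halfCost false n)) ℕ.* (4 ℕ.+ 4 ℕ.* d)
gap d k n m x n≡ m≡ x≤ = begin-strict
  a ℕ.* x ℕ.+ r
    ≤⟨ ℕ.+-monoˡ-≤ r (ℕ.*-monoʳ-≤ a x≤) ⟩
  a ℕ.* (m ℕ.* (halfCost false n ℕ.+ halfCost false n)) ℕ.+ r
    ≡⟨ cong (λ z → a ℕ.* (m ℕ.* z) ℕ.+ r) (trans
         (solve 2 (λ T n → (T :+ (T :+ n)) :+ (T :+ (T :+ n)) := con 2 :* (con 2 :* T) :+ con 2 :* n)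
           refl T n)
         (cong (λ z → 2 ℕ.* z ℕ.+ 2 ℕ.* n) (2*rise 0 n))) ⟩
  a ℕ.* (m ℕ.* (2 ℕ.* (n ℕ.* suc n) ℕ.+ 2 ℕ.* n)) ℕ.+ r
    <⟨ length-choice d k n m n≡ m≡ ⟩
  (m ℕ.* (3 ℕ.* (n ℕ.* suc n) ℕ.+ 2 ℕ.* n ℕ.+ 4 ℕ.* (n ℕ.* n))) ℕ.* (2 ℕ.+ 2 ℕ.* d)
    ≡⟨ cong (λ z → (m ℕ.* (3 ℕ.* z ℕ.+ 2 ℕ.* n ℕ.+ 4 ℕ.* (n ℕ.* n))) ℕ.* (2 ℕ.+ 2 ℕ.* d))
         (2*rise 0 n) ⟨
  (m ℕ.* (3 ℕ.* (2 ℕ.* T) ℕ.+ 2 ℕ.* n ℕ.+ 4 ℕ.* (n ℕ.* n))) ℕ.* (2 ℕ.+ 2 ℕ.* d)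
    ≡⟨ solve 4 (λ m T n d →
         (m :* (con 3 :* (con 2 :* T) :+ con 2 :* n :+ con 4 :* (n :* n))) :* (con 2 :+ con 2 :* d) :=
         (m :* ((T :+ n :* (con 2 :* n)) :+ (T :+ (T :+ n)))) :* (con 4 :+ con 4 :* d))
         refl m T n d ⟩
  (m ℕ.* (halfCost true n ℕ.+ halfCost false n)) ℕ.* (4 ℕ.+ 4 ℕ.* d)
    ∎
  where
  open ℕ.≤-Reasoning
  T = rise 0 n
  a = 6 ℕ.+ 7 ℕ.* d
  r = k ℕ.* (4 ℕ.+ 4 ℕ.* d)

-- Abstract n and m keep OPT from being unfolded.
ratio>c : ∀ c b n m → c < + 7 / 4 →
  n ≡ 10 ℕ.+ 9 ℕ.* ℚ.denominator-1 c → m ≡ suc (suc (ℚ.denominator-1 c) ℕ.* ℤ.∣ ℚ.↥ b ∣) →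
  ∃[ I ] c * (+ OPT I / 1) + b < + (MTFO I ℕ.⊓ MTFE I) / 1
ratio>c c b n m c< n≡ m≡ = worst n m ,
  subst (λ y → c * (+ OPT (worst n m) / 1) + b < + y / 1) (sym (min-worst n m))
    (below c b (OPT (worst n m)) (m ℕ.* (halfCost true n ℕ.+ halfCost false n)) c<
      (gap (ℚ.denominator-1 c) ℤ.∣ ℚ.↥ b ∣ n m (OPT (worst n m)) n≡ m≡ (OPT-worst n m)))

theorem6 : (∀ (I : Instance) → MTFO I ℕ.⊓ MTFE I ℕ.≤ 2 ℕ.* OPT I)
    ×
    (∀ (c b : ℚ) → c < + 7 / 4 →
    ∃[ I ] c * (+ OPT I / 1) + b < + (MTFO I ℕ.⊓ MTFE I) / 1)
theorem6 = MTFO⊓MTFE≤2OPT , λ c b c< → ratio>c c b _ _ c< refl refl
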